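{- For every DBI normal formula $\varphi$ and every pointed Kripke model $(\mathcal{M},v)$, the pointed update of $(\mathcal{M},v)$ with $(\mathcal{U}_\varphi,0)$ is defined and $\mathcal{M}\odot\mathcal{U}_\varphi,(v,0)\vDash\varphi$.
   Context: Agents $\mathcal{A}=\{1,\dots,n\}$, $n>1$; language $\mathcal{L}$: $\varphi ::= p \mid \neg\varphi \mid (\varphi\wedge\varphi)\mid B_i\varphi$, with $\top$ the usual tautology. Kripke model $\mathcal{M}=\langle S,R,V\rangle$ (nonempty $S$, $R_i\subseteq S\times S$, $V:\mathit{Prop}\to 2^S$), standard truth ($\mathcal{M},w\vDash B_i\varphi$ iff $\varphi$ holds at all $R_i$-successors). Action model $\mathcal{U}=\langle E,Q,\mathsf{pre}\rangle$ (nonempty $E$, $Q_i\subseteq E\times E$, $\mathsf{pre}:E\to\mathcal{L}$). Pointed update of $(\mathcal{M},w)$ with $(\mathcal{U},\alpha)$, defined iff $\mathcal{M},w\vDash\mathsf{pre}(\alpha)$: with $T=\{(x,\beta)\in S\times E\mid\mathcal{M},x\vDash\mathsf{pre}(\beta)\}$, $\mathcal{M}\odot\mathcal{U}=\langle S^{\mathcal U},R^{\mathcal U},V^{\mathcal U}\rangle$, where $S^{\mathcal U}$ is the smallest subset of $T$ containing $(w,\alpha)$ closed under: $(x,\beta)\in S^{\mathcal U}$, $(u,\gamma)\in T$, $xR_iu$, $\beta Q_i\gamma$ imply $(u,\gamma)\in S^{\mathcal U}$; $R^{\mathcal U}_i$ relates $(x,\beta),(u,\gamma)\in S^{\mathcal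 U}$ iff $xR_iu$ and $\beta Q_i\gamma$; $V^{\mathcal U}(p)=\{(x,\beta)\in S^{\mathcal U}\mid x\in V(p)\}$. The resulting pointed model is $(\mathcal{M}\odot\mathcal{U},(w,\alpha))$. Target agents: $\mathsf{ta}(p)=\varnothing$, $\mathsf{ta}(\neg\phi)=\mathsf{ta}(\phi)$, $\mathsf{ta}(\phi\wedge\psi)=\mathsf{ta}(\phi)\cup\mathsf{ta}(\psi)$, $\mathsf{ta}(B_i\phi)=\{i\}$. DBI formulas: $\varphi ::= B_i\xi \mid B_i(\xi\wedge\varphi)\mid(\varphi\wedge\varphi)\mid B_i\varphi$ with $\xi$ purely propositional. DBI normal: $B_i\xi$ always; $B_i\varphi$ and $B_i(\xi\wedge\varphi)$ iff $\varphi$ is DBI normal and $i\notin\mathsf{ta}(\varphi)$; $\varphi\wedge\psi$ iff both are DBI normal and $\mathsf{ta}(\varphi)\cap\mathsf{ta}(\psi)=\varnothing$. The action model $\mathcal{U}_\varphi=\langle E^\varphi,Q^\varphi,\mathsf{pre}^\varphi\rangle$ for DBI normal $\varphi$ is defined recursively; always $E^\varphi=\{0,-1\}\sqcup D^\varphi$ with $\varnothing\neq D^\varphi\subseteq\{1,2,\dots\}$, $\mathsf{pre}^\varphi(0)=\mathsf{pre}^\varphi(-1)=\top$. For a relation $Q_j$ write $\underline{Q}_j=Q_j\cap((E\setminus\{0\})\times(E\setminus\{0\}))$. (1) $\varphi=B_i\xi$, $\xi$ propositional: $D^\varphi=\{m\}$, $\mathsf{pre}(m)=\xi$, $Q_j=\{(0,-1),(m,-1),(-1,-1)\}$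 for $j\neq i$, $Q_i=\{(0,m),(m,m),(-1,-1)\}$. (2) $\varphi=B_i\psi$, $\psi$ DBI normal: with a fresh $m\geq1$, $m\notin D^\psi$, let $D^\varphi=D^\psi\sqcup\{m\}$, $\mathsf{pre}^\varphi$ extends $\mathsf{pre}^\psi$ by $\mathsf{pre}^\varphi(m)=\top$, $Q^\varphi_j=\underline{Q}^\psi_j\cup\{(0,-1)\}\cup\{(m,k)\mid(0,k)\in Q^\psi_j\}$ for $j\neq i$, and $Q^\varphi_i=\underline{Q}^\psi_i\cup\{(0,m),(m,m)\}$. (3) $\varphi=B_i(\xi\wedge\psi)$, $\xi$ propositional, $\psi$ DBI normal: as in (2) except $\mathsf{pre}^\varphi(m)=\xi$. (4) $\varphi=\psi\wedge\theta$ with $\psi,\theta$ DBI normal: rename so that $D^\psi\cap D^\theta=\varnothing$; $D^\varphi=D^\psi\sqcup D^\theta$, $\mathsf{pre}^\varphi=\mathsf{pre}^\psi\cup\mathsf{pre}^\theta$, and for every $j$: $Q^\varphi_j=\underline{Q}^\psi_j\cup\underline{Q}^\theta_j\cup\{(0,k)\mid (0,k)\in Q^\psi_j\cup Q^\theta_j,\ k\in D^\psi\sqcup D^\theta\}\cup\{(0,-1)\mid \text{there is no } k\in D^\psi\sqcup D^\theta \text{ with } (0,k)\in Q^\psi_j\cup Q^\theta_j\}$. -}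

module Defs where

open import Data.Bool using (if_then_else_)
open import Data.Empty using (⊥; ⊥-elim)
open import Data.Fin using (Fin)
open import Data.Fin.Properties using (_≟_)
open import Data.Fin.Subset as Subset using (Subset; ⁅_⁆; _∉_)
open import Data.Maybe using (Maybe; just; nothing)
open import Data.Nat using (ℕ)
open import Data.Product using (Σ; ∃; ∃-syntax; ∃₂; _×_; _,_; proj₁; proj₂)
open import Data.Sum using (_⊎_; inj₁; inj₂)
open import Data.Unit using (⊤; tt)
open import Level using (Level; 0ℓ) renaming (suc to lsuc)
open import Relation.Binary.Construct.Union using (_∪_)
open import Relation.Binary.Core using (Rel)
open import Relation.Binary.PropositionalEquality
  using (_≡_; _≢_; refl; cong; cong₂)
open import Relation.Nullary using (¬_; does)

private variable
  ℓ : Level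
  n : ℕ
  At D D′ : Set

------------------------------------------------------------------------
-- Language

infixr 7 _∧ᶠ_
infix  8 ¬ᶠ_

data Form (n : ℕ) (At : Set) : Set where
  atom : At → Form n At
  ¬ᶠ_  : Form n At → Form n At
  _∧ᶠ_ : Form n At → Form n At → Form n At
  B    : Fin n → Form n At → Form n At

-- The grammar has no constant for truth, so an atom has to be supplied.
⊤ᶠ : At → Form n At
⊤ᶠ p = ¬ᶠ (atom p ∧ᶠ ¬ᶠ atom p)

------------------------------------------------------------------------
-- Kripke semantics

record KripkeModel (ℓ : Level) (n : ℕ) (At : Set) : Set (lsuc ℓ) where
  field
    S        : Set ℓ
    nonempty : S
    R        : Fin n → Rel S ℓ
    V        : At → S → Set ℓ

infix 4 _∙_⊨_

_∙_⊨_ : (M : KripkeModel ℓ n At) → KripkeModel.S M → Form n At → Set ℓ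
M ∙ w ⊨ atom p  = KripkeModel.V M p w
M ∙ w ⊨ ¬ᶠ φ    = ¬ (M ∙ w ⊨ φ)
M ∙ w ⊨ φ ∧ᶠ ψ  = (M ∙ w ⊨ φ) × (M ∙ w ⊨ ψ)
M ∙ w ⊨ B i φ   = ∀ u → KripkeModel.R M i w u → M ∙ u ⊨ φ

------------------------------------------------------------------------
-- Action models and pointed updates

record ActionModel (n : ℕ) (At : Set) : Set₁ where
  field
    E        : Set
    nonempty : E
    Q        : Fin n → Rel E 0ℓ
    pre      : E → Form n At

module Update (M : KripkeModel ℓ n At) (w : KripkeModel.S M)
              (U : ActionModel n At) (α : ActionModel.E U) where
  open KripkeModel M using (S; R; V)
  open ActionModel U using (E; Q; pre)

  T : S × E → Set ℓ
  T (x , β) = M ∙ x ⊨ pre β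

  Defined : Set ℓ
  Defined = T (w , α)

  data Sᵁ : S × E → Set ℓ where
    start : T (w , α) → Sᵁ (w , α)
    step  : ∀ {i x β u γ} →
            Sᵁ (x , β) → T (u , γ) → R i x u → Q i β γ → Sᵁ (u , γ)

  point : Defined → Σ (S × E) Sᵁ
  point def = (w , α) , start def

  -- A pair may carry several membership proofs in the domain; neither the
  -- relations nor the valuation distinguishes between them.
  updated : Defined → KripkeModel ℓ n At
  updated def = record
    { S        = Σ (S × E) Sᵁ
    ; nonempty = point def
    ; R        = λ i ((x , β) , _) ((u , γ) , _) → R i x u × Q i β γ
    ; V        = λ p ((x , _) , _) → V p x
    }

------------------------------------------------------------------------
-- DBI formulas and DBI normality

ta : Form n At → Subset n
ta (atom p)  = Subset.⊥
ta (¬ᶠ φ)    = ta φ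
ta (φ ∧ᶠ ψ)  = ta φ Subset.∪ ta ψ
ta (B i φ)   = ⁅ i ⁆

data Propositional {n : ℕ} {At : Set} : Form n At → Set where
  atom : ∀ p → Propositional (atom p)
  ¬ᵖ_  : ∀ {ξ} → Propositional ξ → Propositional (¬ᶠ ξ)
  _∧ᵖ_ : ∀ {ξ χ} → Propositional ξ → Propositional χ →
         Propositional (ξ ∧ᶠ χ)

data DBI {n : ℕ} {At : Set} : Form n At → Set where
  B-prop : ∀ i {ξ} → Propositional ξ → DBI (B i ξ)
  B-both : ∀ i {ξ φ} → Propositional ξ → DBI φ → DBI (B i (ξ ∧ᶠ φ))
  _∧ᵈ_   : ∀ {φ ψ} → DBI φ → DBI ψ → DBI (φ ∧ᶠ ψ)
  B-dbi  : ∀ i {φ} → DBI φ → DBI (B i φ)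

Normal : {φ : Form n At} → DBI φ → Set
Normal (B-prop i _)             = ⊤
Normal (B-both i {φ = φ} _ d)   = Normal d × i ∉ ta φ
Normal (_∧ᵈ_ {φ} {ψ} d e)       =
  (Normal d × Normal e) × (ta φ Subset.∩ ta ψ ≡ Subset.⊥)
Normal (B-dbi i {φ} d)          = Normal d × i ∉ ta φ

-- The grammar is unambiguous, so anything defined by recursion on a
-- derivation of DBI φ depends on φ only.

Propositional-irrelevant : {ξ : Form n At} (a b : Propositional ξ) → a ≡ b
Propositional-irrelevant (atom p) (atom .p)  = refl
Propositional-irrelevant (¬ᵖ a) (¬ᵖ b)       =
  cong ¬ᵖ_ (Propositional-irrelevant a b)
Propositional-irrelevant (a ∧ᵖ a′) (b ∧ᵖ b′) =
  cong₂ _∧ᵖ_ (Propositional-irrelevant a b) (Propositional-irrelevant a′ b′)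

DBI⇒¬Propositional : {φ : Form n At} → DBI φ → ¬ Propositional φ
DBI⇒¬Propositional (d ∧ᵈ _) (a ∧ᵖ _) = DBI⇒¬Propositional d a

DBI-irrelevant : {φ : Form n At} (d e : DBI φ) → d ≡ e
DBI-irrelevant (B-prop i a) (B-prop .i b) =
  cong (B-prop i) (Propositional-irrelevant a b)
DBI-irrelevant (B-prop i (_ ∧ᵖ a)) (B-both .i _ e) =
  ⊥-elim (DBI⇒¬Propositional e a)
DBI-irrelevant (B-prop i a) (B-dbi .i e) = ⊥-elim (DBI⇒¬Propositional e a)
DBI-irrelevant (B-both i _ d) (B-prop .i (_ ∧ᵖ b)) =
  ⊥-elim (DBI⇒¬Propositional d b)
DBI-irrelevant (B-both i a d) (B-both .i b e) =
  cong₂ (B-both i) (Propositional-irrelevant a b) (DBI-irrelevant d e)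
DBI-irrelevant (B-both i a _) (B-dbi .i (e ∧ᵈ _)) =
  ⊥-elim (DBI⇒¬Propositional e a)
DBI-irrelevant (d ∧ᵈ d′) (e ∧ᵈ e′) =
  cong₂ _∧ᵈ_ (DBI-irrelevant d e) (DBI-irrelevant d′ e′)
DBI-irrelevant (B-dbi i d) (B-prop .i b) = ⊥-elim (DBI⇒¬Propositional d b)
DBI-irrelevant (B-dbi i (d ∧ᵈ _)) (B-both .i b _) =
  ⊥-elim (DBI⇒¬Propositional d b)
DBI-irrelevant (B-dbi i d) (B-dbi .i e) = cong (B-dbi i) (DBI-irrelevant d e)

------------------------------------------------------------------------
-- The action model of a DBI formula

-- {0, -1} ⊔ D.  Instead of positive integers with fresh names, D is built
-- with the type formers Maybe (adding a fresh event) and _⊎_ (disjoint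
-- union after renaming).
data Event (D : Set) : Set where
  e₀ e₋₁ : Event D
  ev     : D → Event D

mapEvent : (D → D′) → Event D → Event D′
mapEvent f e₀     = e₀
mapEvent f e₋₁    = e₋₁
mapEvent f (ev k) = ev (f k)

-- The relation Q transported along a renaming f of events.
rename : (D → D′) → Rel (Event D) 0ℓ → Rel (Event D′) 0ℓ
rename f Q x y = ∃₂ λ a b → Q a b × x ≡ mapEvent f a × y ≡ mapEvent f b

-- The underlined relation: Q ∩ ((E ∖ {0}) × (E ∖ {0})).
without₀ : Rel (Event D) 0ℓ → Rel (Event D) 0ℓ
without₀ Q x y = Q x y × x ≢ e₀ × y ≢ e₀

-- The one-element relation {(a , b)}.
infix 7 _↦_
_↦_ : Event D → Event D → Rel (Event D) 0ℓ
(a ↦ b) x y = x ≡ a × y ≡ b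

Q-prop : Fin n → Fin n → Rel (Event ⊤) 0ℓ
Q-prop i j =
  if does (j ≟ i)
  then e₀ ↦ m ∪ m ↦ m ∪ e₋₁ ↦ e₋₁
  else e₀ ↦ e₋₁ ∪ m ↦ e₋₁ ∪ e₋₁ ↦ e₋₁
  where m = ev tt

Q-box : Fin n → (Fin n → Rel (Event D) 0ℓ) →
        Fin n → Rel (Event (Maybe D)) 0ℓ
Q-box i Qψ j =
  if does (j ≟ i)
  then without₀ (Q j) ∪ e₀ ↦ m ∪ m ↦ m
  else without₀ (Q j) ∪ e₀ ↦ e₋₁ ∪ (λ x k → x ≡ m × Q j e₀ k)
  where
  m = ev nothing
  Q = λ j → rename just (Qψ j)

Q-∧ : (Fin n → Rel (Event D) 0ℓ) → (Fin n → Rel (Event D′) 0ℓ) →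
      Fin n → Rel (Event (D ⊎ D′)) 0ℓ
Q-∧ Qψ Qθ j =
    without₀ Q₁
  ∪ without₀ Q₂
  ∪ (λ x y → x ≡ e₀ × ∃[ k ] y ≡ ev k × (Q₁ ∪ Q₂) e₀ (ev k))
  ∪ (λ x y → (e₀ ↦ e₋₁) x y × ¬ (∃[ k ] (Q₁ ∪ Q₂) e₀ (ev k)))
  where
  Q₁ = rename inj₁ (Qψ j)
  Q₂ = rename inj₂ (Qθ j)

Dᵠ : {φ : Form n At} → DBI φ → Set
Dᵠ (B-prop _ _)   = ⊤
Dᵠ (B-both _ _ d) = Maybe (Dᵠ d)
Dᵠ (d ∧ᵈ e)       = Dᵠ d ⊎ Dᵠ e
Dᵠ (B-dbi _ d)    = Maybe (Dᵠ d)

Qᵠ : {φ : Form n At} (d : DBI φ) → Fin n → Rel (Event (Dᵠ d)) 0ℓ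
Qᵠ (B-prop i _)   = Q-prop i
Qᵠ (B-both i _ d) = Q-box i (Qᵠ d)
Qᵠ (d ∧ᵈ e)       = Q-∧ (Qᵠ d) (Qᵠ e)
Qᵠ (B-dbi i d)    = Q-box i (Qᵠ d)

preᴰ : At → {φ : Form n At} (d : DBI φ) → Dᵠ d → Form n At
preᴰ p (B-prop _ {ξ} _)   tt       = ξ
preᴰ p (B-both _ {ξ} _ d) nothing  = ξ
preᴰ p (B-both _ _ d)     (just k) = preᴰ p d k
preᴰ p (d ∧ᵈ e)           (inj₁ k) = preᴰ p d k
preᴰ p (d ∧ᵈ e)           (inj₂ k) = preᴰ p e k
preᴰ p (B-dbi _ d)        nothing  = ⊤ᶠ p
preᴰ p (B-dbi _ d)        (just k) = preᴰ p d k

preᵠ : At → {φ : Form n At} (d : DBI φ) → Event (Dᵠ d) → Form n At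
preᵠ p d e₀     = ⊤ᶠ p
preᵠ p d e₋₁    = ⊤ᶠ p
preᵠ p d (ev k) = preᴰ p d k

-- The recursion does not use normality.  The atom p only serves to write
-- the tautology ⊤ᶠ p.
𝒰 : At → {φ : Form n At} → DBI φ → ActionModel n At
𝒰 p d = record
  { E        = Event (Dᵠ d)
  ; nonempty = e₀
  ; Q        = Qᵠ d
  ; pre      = preᵠ p d
  }

{-# OPTIONS --safe #-}
-- In a DBI normal formula beliefs occur only positively.  So it holds at a
-- world of a model N if the worlds of N can be labelled with events of 𝒰 p d in
-- such a way that they satisfy the preconditions of their labels, every step of
-- N is matched by a step of 𝒰 p d, and the steps from the given world are
-- matched by steps from e₀ for the target agents.  By induction on φ such a
-- labelling restricts to the subformulas: the fresh event m of B i ψ behaves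
-- like the event e₀ of ψ for the agents other than i, and those include ta ψ by
-- normality; in a conjunction e₀ has edges into D exactly for the target agents,
-- so normality separates the edges of the two conjuncts.
module Submission where

open import Defs
open import Data.Fin using (Fin)
open import Data.Fin.Properties using (_≟_)
open import Data.Fin.Subset using (_∈_; _∉_)
open import Data.Fin.Subset.Properties
  using (x∈⁅x⁆; x∈⁅y⁆⇒x≡y; x∈p∪q⁻; x∈p∪q⁺; x∈p∩q⁺; ∉⊥)
open import Data.Maybe using (just; nothing)
open import Data.Nat using (ℕ; _>_)
open import Data.Product using (Σ-syntax; ∃-syntax; _×_; _,_; proj₂)
open import Data.Sum using (_⊎_; inj₁; inj₂)
import Data.Sum as Sum
open import Data.Unit using (tt)
open import Function using (id)
open import Level using (Level; 0ℓ)
open import Relation.Binary.Core using (Rel)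
open import Relation.Binary.PropositionalEquality
  using (_≡_; _≢_; refl; sym; subst; cong; cong₂)
open import Relation.Nullary using (¬_; yes; no; contradiction)

private variable
  ℓ : Level
  n : ℕ
  At D D′ : Set
  φ ξ : Form n At

-- Truth of preconditions before and after the update

⊤ᶠ-valid : (M : KripkeModel ℓ n At) {w : KripkeModel.S M} (p : At) →
           M ∙ w ⊨ ⊤ᶠ p
⊤ᶠ-valid M p (a , ¬a) = ¬a a

-- Membership in the updated domain gives a precondition only at the old world. Being propositional,
-- it keeps its truth value under the update.
preᴰ-propositional : (p : At) (d : DBI φ) (k : Dᵠ d) →
                     Propositional (preᴰ p d k)
preᴰ-propositional p (B-prop _ a)   tt       = a
preᴰ-propositional p (B-both _ a d) nothing  = a
preᴰ-propositional p (B-both _ a d) (just k) = preᴰ-propositional p d k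
preᴰ-propositional p (d ∧ᵈ e)       (inj₁ k) = preᴰ-propositional p d k
preᴰ-propositional p (d ∧ᵈ e)       (inj₂ k) = preᴰ-propositional p e k
preᴰ-propositional p (B-dbi _ d)    nothing  = ¬ᵖ (atom p ∧ᵖ (¬ᵖ atom p))
preᴰ-propositional p (B-dbi _ d)    (just k) = preᴰ-propositional p d k

module _ (M : KripkeModel ℓ n At) (w : KripkeModel.S M)
         (U : ActionModel n At) (α : ActionModel.E U) where
  open Update M w U α

  Sᵁ⇒T : ∀ {z} → Sᵁ z → T z
  Sᵁ⇒T (start t)      = t
  Sᵁ⇒T (step _ t _ _) = t

  -- The update copies the valuation. An equality of types, rather than an implication, lets the
  -- induction pass through negation.
  updated-propositional : (def : Defined) → Propositional ξ →
                          ∀ {x β} (s : Sᵁ (x , β)) →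
                          (updated def ∙ (x , β) , s ⊨ ξ) ≡ (M ∙ x ⊨ ξ)
  updated-propositional def (atom p) s = refl
  updated-propositional def (¬ᵖ a)   s =
    cong ¬_ (updated-propositional def a s)
  updated-propositional def (a ∧ᵖ b) s =
    cong₂ _×_ (updated-propositional def a s) (updated-propositional def b s)

-- Edges of the action models

mapEvent≡ev : {f : D → D′} (a : Event D) {k : D′} → ev k ≡ mapEvent f a →
              ∃[ l ] a ≡ ev l × k ≡ f l
mapEvent≡ev (ev l) refl = l , refl , refl

Q-prop-e₀⁺ : (i : Fin n) → Q-prop i i e₀ (ev tt)
Q-prop-e₀⁺ i with i ≟ i
... | yes _   = inj₁ (refl , refl)
... | no  i≢i = contradiction refl i≢i

Q-prop-e₀⁻ : ∀ (i j : Fin n) {k} → Q-prop i j e₀ (ev k) → j ≡ i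
Q-prop-e₀⁻ i j q with j ≟ i
... | yes j≡i = j≡i
Q-prop-e₀⁻ i j (inj₁ (_ , ()))        | no _
Q-prop-e₀⁻ i j (inj₂ (inj₁ (() , _))) | no _
Q-prop-e₀⁻ i j (inj₂ (inj₂ (() , _))) | no _

Q-prop-e₀-target : ∀ (i : Fin n) {b} → Q-prop i i e₀ b → b ≡ ev tt
Q-prop-e₀-target i q with i ≟ i
... | no i≢i = contradiction refl i≢i
Q-prop-e₀-target i (inj₁ (_ , b≡m))       | yes _ = b≡m
Q-prop-e₀-target i (inj₂ (inj₁ (() , _))) | yes _
Q-prop-e₀-target i (inj₂ (inj₂ (() , _))) | yes _

module _ (Q : Fin n → Rel (Event D) 0ℓ) where

  Q-box-e₀⁺ : (i : Fin n) → Q-box i Q i e₀ (ev nothing)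
  Q-box-e₀⁺ i with i ≟ i
  ... | yes _   = inj₂ (inj₁ (refl , refl))
  ... | no  i≢i = contradiction refl i≢i

  Q-box-e₀⁻ : ∀ i j {k} → Q-box i Q j e₀ (ev k) → j ≡ i
  Q-box-e₀⁻ i j q with j ≟ i
  ... | yes j≡i = j≡i
  Q-box-e₀⁻ i j (inj₁ (_ , e₀≢e₀ , _)) | no _ = contradiction refl e₀≢e₀
  Q-box-e₀⁻ i j (inj₂ (inj₁ (_ , ()))) | no _
  Q-box-e₀⁻ i j (inj₂ (inj₂ (() , _))) | no _

  Q-box-e₀-target : ∀ i {b} → Q-box i Q i e₀ b → b ≡ ev nothing
  Q-box-e₀-target i q with i ≟ i
  ... | no i≢i = contradiction refl i≢i
  Q-box-e₀-target i (inj₁ (_ , e₀≢e₀ , _))  | yes _ = contradiction refl e₀≢e₀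
  Q-box-e₀-target i (inj₂ (inj₁ (_ , b≡m))) | yes _ = b≡m
  Q-box-e₀-target i (inj₂ (inj₂ (() , _)))  | yes _

  -- For agents other than `i` the fresh event copies the edges of the old `e₀`, so it can stand in
  -- for `e₀` in the model of the subformula.
  Q-box-fresh : ∀ i j {b} → j ≢ i → Q-box i Q j (ev nothing) b →
                ∃[ c ] Q j e₀ c × b ≡ mapEvent just c
  Q-box-fresh i j j≢i q with j ≟ i
  ... | yes j≡i = contradiction j≡i j≢i
  -- An old edge has its source in the image of `mapEvent just`, which misses the fresh event.
  Q-box-fresh i j _ (inj₁ ((a , _ , _ , eq , _) , _)) | no _
    with mapEvent≡ev a eq
  ... | _ , _ , ()
  Q-box-fresh i j _ (inj₂ (inj₁ (() , _))) | no _
  Q-box-fresh i j _ (inj₂ (inj₂ (_ , e₀ , c , q , refl , b≡c))) | no _ =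
    c , q , b≡c

  -- Every added edge starts at `e₀` or at the fresh event, so the old events in D stay closed under
  -- outgoing edges.
  Q-box-just : ∀ i j {k b} → Q-box i Q j (ev (just k)) b →
               ∃[ c ] Q j (ev k) c × b ≡ mapEvent just c
  Q-box-just i j q with j ≟ i
  Q-box-just i j (inj₁ ((ev _ , c , q , refl , b≡c) , _)) | yes _ = c , q , b≡c
  Q-box-just i j (inj₂ (inj₁ (() , _)))                   | yes _
  Q-box-just i j (inj₂ (inj₂ (() , _)))                   | yes _
  Q-box-just i j (inj₁ ((ev _ , c , q , refl , b≡c) , _)) | no _ = c , q , b≡c
  Q-box-just i j (inj₂ (inj₁ (() , _)))                   | no _
  Q-box-just i j (inj₂ (inj₂ (() , _)))                   | no _

rename-e₀-ev : {Q : Rel (Event D) 0ℓ} {f : D → D′} {k : D′} →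
               rename f Q e₀ (ev k) → ∃[ l ] Q e₀ (ev l) × k ≡ f l
rename-e₀-ev (e₀ , ev l , q , refl , refl) = l , q , refl

module _ (Q : Fin n → Rel (Event D) 0ℓ) (Q′ : Fin n → Rel (Event D′) 0ℓ)
         (j : Fin n) where

  Q-∧-e₀⁻ : ∀ {k} → Q-∧ Q Q′ j e₀ (ev k) →
            (∃[ l ] Q j e₀ (ev l) × k ≡ inj₁ l) ⊎
            (∃[ l ] Q′ j e₀ (ev l) × k ≡ inj₂ l)
  Q-∧-e₀⁻ (inj₁ (_ , e₀≢e₀ , _))        = contradiction refl e₀≢e₀
  Q-∧-e₀⁻ (inj₂ (inj₁ (_ , e₀≢e₀ , _))) = contradiction refl e₀≢e₀
  Q-∧-e₀⁻ (inj₂ (inj₂ (inj₁ (_ , _ , refl , q)))) =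
    Sum.map rename-e₀-ev rename-e₀-ev q
  Q-∧-e₀⁻ (inj₂ (inj₂ (inj₂ ((_ , ()) , _))))

  Q-∧-e₀-inj₁ : ∀ {k} → Q j e₀ (ev k) → Q-∧ Q Q′ j e₀ (ev (inj₁ k))
  Q-∧-e₀-inj₁ q =
    inj₂ (inj₂ (inj₁ (refl , _ , refl , inj₁ (_ , _ , q , refl , refl))))

  Q-∧-e₀-inj₂ : ∀ {k} → Q′ j e₀ (ev k) → Q-∧ Q Q′ j e₀ (ev (inj₂ k))
  Q-∧-e₀-inj₂ q =
    inj₂ (inj₂ (inj₁ (refl , _ , refl , inj₂ (_ , _ , q , refl , refl))))

  -- The default edge from `e₀` to `e₋₁` is present only when no edge from `e₀` into D exists; one
  -- such edge excludes it.
  Q-∧-e₀-target : ∀ {k b} → Q-∧ Q Q′ j e₀ (ev k) → Q-∧ Q Q′ j e₀ b →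
                  ∃[ l ] b ≡ ev l
  Q-∧-e₀-target _ (inj₁ (_ , e₀≢e₀ , _))        = contradiction refl e₀≢e₀
  Q-∧-e₀-target _ (inj₂ (inj₁ (_ , e₀≢e₀ , _))) = contradiction refl e₀≢e₀
  Q-∧-e₀-target _ (inj₂ (inj₂ (inj₁ (_ , l , b≡l , _)))) = l , b≡l
  Q-∧-e₀-target q (inj₂ (inj₂ (inj₂ (_ , none)))) with q
  ... | inj₁ (_ , e₀≢e₀ , _)        = contradiction refl e₀≢e₀
  ... | inj₂ (inj₁ (_ , e₀≢e₀ , _)) = contradiction refl e₀≢e₀
  ... | inj₂ (inj₂ (inj₁ (_ , k , _ , q′))) = contradiction (k , q′) none
  ... | inj₂ (inj₂ (inj₂ ((_ , ()) , _)))

  Q-∧-inj₁ : ∀ {k b} → Q-∧ Q Q′ j (ev (inj₁ k)) b →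
             ∃[ c ] Q j (ev k) c × b ≡ mapEvent inj₁ c
  Q-∧-inj₁ (inj₁ ((ev _ , c , q , refl , b≡c) , _)) = c , q , b≡c
  Q-∧-inj₁ (inj₂ (inj₁ ((a , _ , _ , eq , _) , _))) with mapEvent≡ev a eq
  ... | _ , _ , ()
  Q-∧-inj₁ (inj₂ (inj₂ (inj₁ (() , _))))
  Q-∧-inj₁ (inj₂ (inj₂ (inj₂ ((() , _) , _))))

  Q-∧-inj₂ : ∀ {k b} → Q-∧ Q Q′ j (ev (inj₂ k)) b →
             ∃[ c ] Q′ j (ev k) c × b ≡ mapEvent inj₂ c
  Q-∧-inj₂ (inj₁ ((a , _ , _ , eq , _) , _)) with mapEvent≡ev a eq
  ... | _ , _ , ()
  Q-∧-inj₂ (inj₂ (inj₁ ((ev _ , c , q , refl , b≡c) , _))) = c , q , b≡c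
  Q-∧-inj₂ (inj₂ (inj₂ (inj₁ (() , _))))
  Q-∧-inj₂ (inj₂ (inj₂ (inj₂ ((() , _) , _))))

-- Used to tell which conjunct an edge from `e₀` belongs to, as normality allows each agent to be a
-- target of only one.
Qᵠ-e₀⇒∈ta : (d : DBI φ) → ∀ {j k} → Qᵠ d j e₀ (ev k) → j ∈ ta φ
Qᵠ-e₀⇒∈ta (B-prop i _) {j} q with refl ← Q-prop-e₀⁻ i j q = x∈⁅x⁆ i
Qᵠ-e₀⇒∈ta (B-both i _ d) {j} q with refl ← Q-box-e₀⁻ (Qᵠ d) i j q = x∈⁅x⁆ i
Qᵠ-e₀⇒∈ta (B-dbi i d) {j} q with refl ← Q-box-e₀⁻ (Qᵠ d) i j q = x∈⁅x⁆ i
Qᵠ-e₀⇒∈ta (d ∧ᵈ e) {j} q =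
  x∈p∪q⁺ (Sum.map (λ (_ , q₁ , _) → Qᵠ-e₀⇒∈ta d q₁)
                  (λ (_ , q₂ , _) → Qᵠ-e₀⇒∈ta e q₂)
                  (Q-∧-e₀⁻ (Qᵠ d) (Qᵠ e) j q))

-- Supplies the edge into D that excludes the default edge for the target agents of a conjunction.
∈ta⇒Qᵠ-e₀ : (d : DBI φ) → ∀ {j} → j ∈ ta φ → ∃[ k ] Qᵠ d j e₀ (ev k)
∈ta⇒Qᵠ-e₀ (B-prop i _) j∈ with refl ← x∈⁅y⁆⇒x≡y i j∈ = tt , Q-prop-e₀⁺ i
∈ta⇒Qᵠ-e₀ (B-both i _ d) j∈ with refl ← x∈⁅y⁆⇒x≡y i j∈ =
  nothing , Q-box-e₀⁺ (Qᵠ d) i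
∈ta⇒Qᵠ-e₀ (B-dbi i d) j∈ with refl ← x∈⁅y⁆⇒x≡y i j∈ =
  nothing , Q-box-e₀⁺ (Qᵠ d) i
∈ta⇒Qᵠ-e₀ (_∧ᵈ_ {φ} {ψ} d e) {j} j∈ with x∈p∪q⁻ (ta φ) (ta ψ) j∈
... | inj₁ j∈φ = let k , q = ∈ta⇒Qᵠ-e₀ d j∈φ in inj₁ k , Q-∧-e₀-inj₁ (Qᵠ d) (Qᵠ e) j q
... | inj₂ j∈ψ = let k , q = ∈ta⇒Qᵠ-e₀ e j∈ψ in inj₂ k , Q-∧-e₀-inj₂ (Qᵠ d) (Qᵠ e) j q

-- Labellings and soundness

module _ (p : At) (N : KripkeModel ℓ n At) where
  open KripkeModel N using (S; R)

  -- Nothing is required of the worlds labelled e₀ or e₋₁: the former are never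
  -- reached again, and no belief of φ speaks about the latter.
  record Labelling {φ : Form n At} (d : DBI φ) (Z : S → Event (Dᵠ d) → Set) :
                   Set ℓ where
    field
      pre   : ∀ {x k} → Z x (ev k) → N ∙ x ⊨ preᴰ p d k
      forth : ∀ {j x y k} → Z x (ev k) → R j x y →
              ∃[ b ] Qᵠ d j (ev k) b × Z y b

  open Labelling

  -- Since `Z` is a relation, worlds with labels outside the image of `mapEvent f` may become
  -- unlabelled. By the hypothesis on edges, steps from worlds labelled by `ev k` never lead to such
  -- a label.
  restrict : ∀ {φ ψ : Form n At} {d : DBI φ} {e : DBI ψ} {Z}
             (f : Dᵠ e → Dᵠ d) →
             (∀ k → preᴰ p d (f k) ≡ preᴰ p e k) →
             (∀ j {k b} → Qᵠ d j (ev (f k)) b →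
              ∃[ c ] Qᵠ e j (ev k) c × b ≡ mapEvent f c) →
             Labelling d Z → Labelling e (λ x a → Z x (mapEvent f a))
  restrict f pre≡ Q⁻ L .pre {k = k} z =
    subst (N ∙ _ ⊨_) (pre≡ k) (L .pre z)
  restrict f pre≡ Q⁻ L .forth {j} z r with L .forth z r
  ... | _ , q , z′ with Q⁻ j q
  ... | c , q′ , refl = c , q′ , z′

  -- The world `s` need not carry the label `e₀`: only its steps matter, and only those of target
  -- agents. This lets a world labelled by the fresh event serve as the root for the subformula.
  sound : ∀ {φ : Form n At} (d : DBI φ) → Normal d →
          ∀ {Z} → Labelling d Z → ∀ s →
          (∀ {j y} → j ∈ ta φ → R j s y → ∃[ b ] Qᵠ d j e₀ b × Z y b) →
          N ∙ s ⊨ φ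

  sound-fresh : ∀ {i} {ψ : Form n At} (d : DBI ψ) → Normal d → i ∉ ta ψ →
                ∀ {Z} → Labelling d (λ x a → Z x (mapEvent just a)) → ∀ s →
                (∀ {j y} → R j s y →
                 ∃[ b ] Q-box i (Qᵠ d) j (ev nothing) b × Z y b) →
                N ∙ s ⊨ ψ
  sound-fresh {i} {ψ} d nd i∉ {Z} L s out =
    sound d nd {λ x a → Z x (mapEvent just a)} L s out′
    where
    out′ : ∀ {j y} → j ∈ ta ψ → R j s y →
           ∃[ c ] Qᵠ d j e₀ c × Z y (mapEvent just c)
    -- Here normality enters: `j` is a target agent of `ψ`, hence differs from `i`.
    out′ {j} j∈ r with out r
    ... | _ , q , z with Q-box-fresh (Qᵠ d) i j (λ { refl → i∉ j∈ }) q
    ... | c , q′ , refl = c , q′ , z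

  sound (B-prop i _) _ L s out u r with out (x∈⁅x⁆ i) r
  ... | _ , q , z with refl ← Q-prop-e₀-target i q = L .pre z
  -- The only edge of `i` from `e₀` leads to the fresh event, so `u` has that label: its
  -- precondition gives the propositional part, its outgoing steps the rest.
  sound (B-both i _ d) (nd , i∉) {Z} L s out u r with out (x∈⁅x⁆ i) r
  ... | _ , q , z with refl ← Q-box-e₀-target (Qᵠ d) i q =
    L .pre z ,
    sound-fresh d nd i∉ {Z}
      (restrict {Z = Z} just (λ _ → refl) (Q-box-just (Qᵠ d) i) L)
      u (L .forth z)
  sound (B-dbi i d) (nd , i∉) {Z} L s out u r with out (x∈⁅x⁆ i) r
  ... | _ , q , z with refl ← Q-box-e₀-target (Qᵠ d) i q =
    sound-fresh d nd i∉ {Z}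
      (restrict {Z = Z} just (λ _ → refl) (Q-box-just (Qᵠ d) i) L)
      u (L .forth z)
  sound (_∧ᵈ_ {φ} {ψ} d e) ((nd , ne) , disj) {Z} L s out =
    sound d nd {λ x a → Z x (mapEvent inj₁ a)}
      (restrict {Z = Z} inj₁ (λ _ → refl) (Q-∧-inj₁ (Qᵠ d) (Qᵠ e)) L) s out₁ ,
    sound e ne {λ x a → Z x (mapEvent inj₂ a)}
      (restrict {Z = Z} inj₂ (λ _ → refl) (Q-∧-inj₂ (Qᵠ d) (Qᵠ e)) L) s out₂
    where
    disjoint : ∀ {j} → j ∈ ta φ → ¬ (j ∈ ta ψ)
    disjoint j∈φ j∈ψ = ∉⊥ (subst (_ ∈_) disj (x∈p∩q⁺ (j∈φ , j∈ψ)))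

    outᴰ : ∀ {j y} → j ∈ ta (φ ∧ᶠ ψ) → R j s y →
           ∃[ k ] Q-∧ (Qᵠ d) (Qᵠ e) j e₀ (ev k) × Z y (ev k)
    outᴰ {j} j∈ r with out j∈ r
    ... | _ , q , z
      with Q-∧-e₀-target (Qᵠ d) (Qᵠ e) j (proj₂ (∈ta⇒Qᵠ-e₀ (d ∧ᵈ e) j∈)) q
    ... | k , refl = k , q , z

    out₁ : ∀ {j y} → j ∈ ta φ → R j s y →
           ∃[ c ] Qᵠ d j e₀ c × Z y (mapEvent inj₁ c)
    out₁ {j} j∈ r with outᴰ (x∈p∪q⁺ (inj₁ j∈)) r
    ... | _ , q , z with Q-∧-e₀⁻ (Qᵠ d) (Qᵠ e) j q
    ... | inj₁ (l , q₁ , refl) = ev l , q₁ , z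
    -- An edge into the second conjunct would make `j` a target agent of both.
    ... | inj₂ (_ , q₂ , _)    = contradiction (Qᵠ-e₀⇒∈ta e q₂) (disjoint j∈)

    out₂ : ∀ {j y} → j ∈ ta ψ → R j s y →
           ∃[ c ] Qᵠ e j e₀ c × Z y (mapEvent inj₂ c)
    out₂ {j} j∈ r with outᴰ (x∈p∪q⁺ (inj₂ j∈)) r
    ... | _ , q , z with Q-∧-e₀⁻ (Qᵠ d) (Qᵠ e) j q
    ... | inj₁ (_ , q₁ , _)    = contradiction j∈ (disjoint (Qᵠ-e₀⇒∈ta d q₁))
    ... | inj₂ (l , q₂ , refl) = ev l , q₂ , z

theorem4 : ∀ {ℓ : Level} (n : ℕ) → n > 1 → (At : Set) (p : At) →
    (φ : Form n At) (d : DBI φ) → Normal d →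
    (M : KripkeModel ℓ n At) (v : KripkeModel.S M) →
    let open Update M v (𝒰 p d) e₀ in
    Σ[ def ∈ Defined ] (updated def ∙ point def ⊨ φ)
theorem4 n _ At p φ d nd M v =
  def , sound p (updated def) d nd labelling (point def)
          (λ { _ (_ , q) → _ , q , refl })
  where
  open Update M v (𝒰 p d) e₀

  def : Defined
  def = ⊤ᶠ-valid M p

  -- Each world of the update is labelled by its own event, so `forth` is read off the event
  -- component of the updated relation.
  labelling : Labelling p (updated def) d (λ { ((_ , β) , _) b → β ≡ b })
  labelling .Labelling.pre {x = _ , s} {k} refl =
    subst id (sym (updated-propositional M v (𝒰 p d) e₀ def
                    (preᴰ-propositional p d k) s))
      (Sᵁ⇒T M v (𝒰 p d) e₀ s)
  labelling .Labelling.forth refl (_ , q) = _ , q , refl
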